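{- For every cubic graph $G$, $\nu_2(G) \geq \frac{4}{5}\cdot |V(G)|$.
   Context: Graphs are finite, without loops, possibly with multiple edges; a graph is cubic if every vertex has degree $3$. For $k\geq 1$, $\nu_k(G)$ is the maximum number of edges of a $k$-edge-colorable subgraph of $G$. -}

module Defs where

open import Data.Empty using (⊥-elim)
open import Data.Fin.Base using (Fin; zero; funToFin; finToFun)
open import Data.Fin.Properties as Fin using (finToFun-funToFin)
open import Data.Fin.Subset using (Subset; _∈_; ∣_∣; ⊤; ⊥)
open import Data.Fin.Subset.Properties
  using (_∈?_; ∈⊤; ∉⊥; ∣⊥∣≡0; ∣p∣≤n; anySubset?; nonempty?)
open import Data.Nat.Base using (ℕ; zero; suc; _≤_; z≤n; _^_)
open import Data.Nat.Properties as ℕ using (m≤n⇒m<n∨m≡n)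
open import Data.Product.Base using (Σ-syntax; ∃; ∃-syntax; _×_; _,_; proj₁; proj₂)
open import Data.Sum.Base using (_⊎_; inj₁; inj₂)
open import Data.Vec.Base using (allFin; count)
open import Data.Vec.Properties.WithK using ([]=-irrelevant)
open import Relation.Binary.PropositionalEquality
  using (_≡_; _≢_; refl; sym; trans; cong; subst)
open import Relation.Nullary.Decidable
  using (Dec; yes; no; map′; ¬?; _×-dec_; _⊎-dec_; _→-dec_)

-- The order in which `ends` lists the two endpoints of an edge carries no
-- meaning: everything below depends on it only through `Incident`.
record Graph : Set where
  field
    order    : ℕ
    size     : ℕ
    ends     : Fin size → Fin order × Fin order
    loopless : ∀ e → proj₁ (ends e) ≢ proj₂ (ends e)

open Graph public

IsMaximum : (ℕ → Set) → ℕ → Set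
IsMaximum P m = P m × (∀ {s} → P s → s ≤ m)

private
  greatest : ∀ {P : ℕ → Set} → (∀ s → Dec (P s)) → P 0 →
             ∀ b → (∀ {s} → P s → s ≤ b) → ∃ (IsMaximum P)
  greatest P? p₀ zero    bound = 0 , p₀ , bound
  greatest {P} P? p₀ (suc b) bound with P? (suc b)
  ... | yes p = suc b , p , bound
  ... | no ¬p = greatest P? p₀ b bound′
    where
    bound′ : ∀ {s} → P s → s ≤ b
    bound′ p with m≤n⇒m<n∨m≡n (bound p)
    ... | inj₁ s<1+b = ℕ.≤-pred s<1+b
    ... | inj₂ s≡1+b = ⊥-elim (¬p (subst P s≡1+b p))

module _ (G : Graph) where

  Incident : Fin (order G) → Fin (size G) → Set
  Incident v e = v ≡ proj₁ (ends G e) ⊎ v ≡ proj₂ (ends G e)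

  incident? : ∀ v e → Dec (Incident v e)
  incident? v e = (v Fin.≟ proj₁ (ends G e)) ⊎-dec (v Fin.≟ proj₂ (ends G e))

  degree : Fin (order G) → ℕ
  degree v = count (incident? v) (allFin (size G))

  Cubic : Set
  Cubic = ∀ v → degree v ≡ 3

  -- Parallel edges are adjacent.
  Adjacent : Fin (size G) → Fin (size G) → Set
  Adjacent e f = e ≢ f × ∃[ v ] (Incident v e × Incident v f)

  adjacent? : ∀ e f → Dec (Adjacent e f)
  adjacent? e f =
    ¬? (e Fin.≟ f) ×-dec Fin.any? (λ v → incident? v e ×-dec incident? v f)

  record Subgraph : Set where
    field
      vertices : Subset (order G)
      edges    : Subset (size G)
      closed   : ∀ {v e} → e ∈ edges → Incident v e → v ∈ vertices

  open Subgraph public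

  spanning : Subset (size G) → Subgraph
  spanning F = record { vertices = ⊤ ; edges = F ; closed = λ _ _ → ∈⊤ }

  EdgeColorable : ℕ → Subgraph → Set
  EdgeColorable k H =
    Σ[ c ∈ (∃ (_∈ edges H) → Fin k) ]
      (∀ e f → Adjacent (proj₁ e) (proj₁ f) → c e ≢ c f)

  HasColorableSubgraph : ℕ → ℕ → Set
  HasColorableSubgraph k s =
    Σ[ H ∈ Subgraph ] (EdgeColorable k H × ∣ edges H ∣ ≡ s)

  private
    -- For a nonempty palette, colorings of F extend to colorings of all
    -- edges, which `finToFun` enumerates.
    Extended : ∀ k → Subset (size G) → Fin (k ^ size G) → Set
    Extended k F i = ∀ e f → e ∈ F → f ∈ F → Adjacent e f →
                     finToFun {k} {size G} i e ≢ finToFun {k} {size G} i f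

    extended? : ∀ k F i → Dec (Extended k F i)
    extended? k F i = Fin.all? λ e → Fin.all? λ f →
      (e ∈? F) →-dec ((f ∈? F) →-dec (adjacent? e f →-dec
        ¬? (finToFun {k} {size G} i e Fin.≟ finToFun {k} {size G} i f)))

    restrict : ∀ k F → ∃ (Extended k F) → EdgeColorable k (spanning F)
    restrict k F (i , p) =
      (λ e → finToFun i (proj₁ e)) ,
      (λ (e , e∈F) (f , f∈F) → p e f e∈F f∈F)

    extend : ∀ k F → EdgeColorable (suc k) (spanning F) → ∃ (Extended (suc k) F)
    extend k F (c , proper) = funToFin g , λ e f e∈F f∈F adj eq →
      proper (e , e∈F) (f , f∈F) adj
        (trans (sym (g-on e∈F)) (trans (sym (finToFun-funToFin g e))
          (trans eq (trans (finToFun-funToFin g f) (g-on f∈F)))))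
      where
      g : Fin (size G) → Fin (suc k)
      g e with e ∈? F
      ... | yes e∈F = c (e , e∈F)
      ... | no  _   = zero

      g-on : ∀ {e} (e∈F : e ∈ F) → g e ≡ c (e , e∈F)
      g-on {e} e∈F with e ∈? F
      ... | yes q   = cong (λ r → c (e , r)) ([]=-irrelevant q e∈F)
      ... | no  e∉F = ⊥-elim (e∉F e∈F)

  edgeColorable? : ∀ k F → Dec (EdgeColorable k (spanning F))
  edgeColorable? zero F with nonempty? F
  ... | yes e  = no λ (c , _) → Fin.¬Fin0 (c e)
  ... | no  ¬e = yes ((λ e → ⊥-elim (¬e e)) , λ e → ⊥-elim (¬e e))
  edgeColorable? (suc k) F =
    map′ (restrict (suc k) F) (extend k F) (Fin.any? (extended? (suc k) F))

  hasColorableSubgraph? : ∀ k s → Dec (HasColorableSubgraph k s)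
  hasColorableSubgraph? k s = map′
    (λ (F , col , eq) → spanning F , col , eq)
    (λ (H , col , eq) → edges H , col , eq)
    (anySubset? λ F → edgeColorable? k F ×-dec (∣ F ∣ ℕ.≟ s))

  maximumColorable : ∀ k → ∃ (IsMaximum (HasColorableSubgraph k))
  maximumColorable k = greatest (hasColorableSubgraph? k)
    (spanning ⊥ , ((λ (_ , e∈⊥) → ⊥-elim (∉⊥ e∈⊥)) ,
                   λ (_ , e∈⊥) → ⊥-elim (∉⊥ e∈⊥)) , ∣⊥∣≡0 (size G))
    (size G)
    λ { (H , _ , refl) → ∣p∣≤n (edges H) }

ν : ℕ → Graph → ℕ
ν k G = proj₁ (maximumColorable G k)

{-# OPTIONS --safe #-}

-- Cover the vertices by disjoint paths, where a path of even length whose ends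
-- are joined by a further edge counts as an even cycle.  Coloring alternately,
-- each of the p components that are not even cycles costs one edge, so it
-- suffices that p ≤ n / 5 in a cover which is optimal in a suitable sense.
-- Call a vertex exposed if its component can be rearranged into a path ending
-- there: all vertices of a cycle, and the ends of an open path.  Exposed
-- vertices of different components, not both even cycles, cannot be adjacent,
-- as the components could be merged; so edges leaving a component other than
-- an even cycle at exposed vertices lead to interior vertices of open paths, each of which receives at most one such edge.  Counting exposed
-- vertices with the neighbors so claimed, an open path owns at least 6
-- vertices, an odd cycle of length at least 5 owns 5, and a short component
-- (an isolated vertex or a triangle) owns at least 4.  If a short component
-- claims an interior vertex x of an open path, then by optimality both pieces
-- left by deleting x are short, which determines x.  Hence there are at most
-- as many short components as open paths, and the average is at least 5.

module Submission where

open import Defs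
open import Algebra.Properties.CommutativeSemigroup using (interchange; x∙yz≈y∙xz)
open import Data.Bool.Base using (true; false)
open import Data.Empty using (⊥; ⊥-elim)
open import Data.Fin.Base using (Fin; zero; suc; opposite)
import Data.Fin.Properties as Fin
open import Data.Fin.Subset as Subset using (Subset; ⁅_⁆; _∪_; ∣_∣)
open import Data.Fin.Subset.Properties
  using (∉⊥; x∈⁅x⁆; x∈⁅y⁆⇒x≡y; x∈p∪q⁻; p⊆p∪q; q⊆p∪q; p⊂q⇒∣p∣<∣q∣)
open import Data.Integer.Base as ℤ using (+_)
import Data.Integer.Properties as ℤ
open import Data.List.Base
  using (List; []; _∷_; _++_; length; filter; tabulate; concatMap; map)
import Data.List.Membership.DecPropositional as DecMembership
open import Data.List.Membership.Propositional using (_∈_; _∉_)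
open import Data.List.Membership.Propositional.Properties
  using (∈-++⁺ˡ; ∈-++⁺ʳ; ∈-++⁻; ∈-filter⁺; ∈-filter⁻; ∈-tabulate⁺)
open import Data.List.Properties
  using (length-++; length-tabulate; ++-assoc; ++-identityʳ; concatMap-++; concatMap-map;
         concatMap-pure; ∷-injective)
open import Data.List.Relation.Binary.Permutation.Propositional
  using (_↭_; refl; prep; swap; ↭-reflexive; ↭-sym; ↭-trans)
open import Data.List.Relation.Binary.Permutation.Propositional.Properties
  using (∈-resp-↭; ↭-length; shift; shifts; ++⁺; ++⁺ˡ; ++⁺ʳ; ++-comm)
open import Data.List.Relation.Unary.All as All using (All; []; _∷_)
import Data.List.Relation.Unary.All.Properties as All
open import Data.List.Relation.Unary.AllPairs using (AllPairs; []; _∷_)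
import Data.List.Relation.Unary.AllPairs.Properties as AllPairs
open import Data.List.Relation.Unary.Any using (here; there)
open import Data.List.Relation.Unary.Unique.Propositional using (Unique)
import Data.List.Relation.Unary.Unique.Propositional.Properties as Unique
open import Data.Nat.Base using (ℕ; zero; suc; _+_; _≤_; _<_; z≤n; s≤s)
import Data.Nat.Base as ℕ
open import Data.Nat.Induction using (<-wellFounded)
import Data.Nat.Properties as ℕ
open import Data.Product.Base using (∃; ∃-syntax; Σ-syntax; _×_; _,_; proj₁; proj₂)
open import Data.Rational.Base using (_/_; _*_; _≥_; toℚᵘ)
import Data.Rational.Properties as ℚ
import Data.Rational.Unnormalised.Base as ℚᵘ
import Data.Rational.Unnormalised.Properties as ℚᵘ
open import Data.Sum.Base using (_⊎_; inj₁; inj₂; [_,_]′)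
open import Data.Vec.Base as Vec using ()
open import Function.Base using (_∘_)
open import Induction.WellFounded using (Acc; acc)
open import Relation.Binary.PropositionalEquality
  using (_≡_; _≢_; refl; sym; trans; cong; cong₂; subst; subst₂; module ≡-Reasoning)
open import Relation.Nullary.Decidable
  using (Dec; yes; no; does; decidable-stable; _×-dec_; ¬?)
open import Relation.Nullary.Negation using (¬_; contradiction)

-- Lists up to permutation, and a pigeonhole principle.

module _ {A : Set} where

  private
    variable
      x y z : A
      xs ys zs : List A

  select : x ∈ xs → ∃[ ys ] xs ↭ x ∷ ys × (∀ {z} → z ∈ xs → z ≡ x ⊎ z ∈ ys)
  select {xs = x ∷ xs} (here refl) = xs , refl , λ { (here e) → inj₁ e ; (there z∈) → inj₂ z∈ }
  select {x} {xs = y ∷ xs} (there x∈) with select x∈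
  ... | ys , p , split = y ∷ ys , ↭-trans (prep y p) (swap y x refl) , λ
    { (here e)   → inj₂ (here e)
    ; (there z∈) → [ inj₁ , inj₂ ∘ there ]′ (split z∈) }

  selectTwo : x ∈ xs → y ∈ xs → x ≡ y ⊎ ∃[ zs ] xs ↭ x ∷ y ∷ zs
  selectTwo (here refl) (here refl) = inj₁ refl
  selectTwo {x} (here refl) (there y∈) with select y∈
  ... | _ , p , _ = inj₂ (_ , prep x p)
  selectTwo {x} {y = y} (there x∈) (here refl) with select x∈
  ... | _ , p , _ = inj₂ (_ , ↭-trans (prep y p) (swap y x refl))
  selectTwo {x} {xs = z ∷ _} {y} (there x∈) (there y∈) with selectTwo x∈ y∈
  ... | inj₁ e       = inj₁ e
  ... | inj₂ (_ , p) = inj₂ (_ , ↭-trans (prep z p) (↭-trans (swap z x refl) (prep x (swap z y refl))))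

  Unique-++⁻ : ∀ xs → Unique (xs ++ ys) →
               Unique xs × Unique ys × (∀ {z} → z ∈ xs → z ∈ ys → ⊥)
  Unique-++⁻ []       u       = [] , u , λ ()
  Unique-++⁻ (x ∷ xs) (p ∷ u) with Unique-++⁻ xs u
  ... | u₁ , u₂ , d =
    All.tabulate (λ z∈ → All.lookup p (∈-++⁺ˡ z∈)) ∷ u₁ , u₂ ,
    λ { (here refl) z∈ys → All.lookup p (∈-++⁺ʳ xs z∈ys) refl ; (there z∈) → d z∈ }

  Unique-resp-↭ : xs ↭ ys → Unique xs → Unique ys
  Unique-resp-↭ refl       u       = u
  Unique-resp-↭ (prep x p) (a ∷ u) =
    All.tabulate (λ z∈ → All.lookup a (∈-resp-↭ (↭-sym p) z∈)) ∷ Unique-resp-↭ p u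
  Unique-resp-↭ (swap x y p) ((x≢y ∷ a) ∷ b ∷ u) =
    ((x≢y ∘ sym) ∷ All.tabulate (λ z∈ → All.lookup b (∈-resp-↭ (↭-sym p) z∈))) ∷
    All.tabulate (λ z∈ → All.lookup a (∈-resp-↭ (↭-sym p) z∈)) ∷ Unique-resp-↭ p u
  Unique-resp-↭ (_↭_.trans p q) u = Unique-resp-↭ q (Unique-resp-↭ p u)

  ++-injective : ∀ (xs xs′ : List A) → length xs ≡ length xs′ →
                 xs ++ ys ≡ xs′ ++ zs → xs ≡ xs′ × ys ≡ zs
  ++-injective []       []        _ e    = refl , e
  ++-injective (x ∷ xs) (y ∷ xs′) l e with ∷-injective e
  ... | refl , e′ with ++-injective xs xs′ (ℕ.suc-injective l) e′
  ... | refl , e″ = refl , e″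

-- Removing the partner of the first element from `ys` leaves partners for all the others, since
-- apart elements share none. The relation `#` is inequality in `Unique-length-≤` and disjointness
-- of components in `shorts≤longs`.
pigeonhole : {A B : Set} {_#_ : A → A → Set} (R : A → B → Set) →
             (∀ {x x′ y} → x # x′ → R x y → R x′ y → ⊥) →
             ∀ {xs} ys → AllPairs _#_ xs → (∀ {x} → x ∈ xs → ∃[ y ] y ∈ ys × R x y) →
             length xs ≤ length ys
pigeonhole R inj ys []        total = z≤n
pigeonhole {A} {B} {_#_} R inj ys (_∷_ {x} {xs} a ap) total with total (here refl)
... | y , y∈ , r with select y∈
... | ys′ , p , split = subst (suc (length xs) ≤_) (sym (↭-length p))
      (s≤s (pigeonhole R inj ys′ ap total′))
  where
  total′ : ∀ {x′} → x′ ∈ xs → ∃[ y ] y ∈ ys′ × R x′ y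
  total′ x′∈ with total (there x′∈)
  ... | y′ , y′∈ , r′ with split y′∈
  ... | inj₁ refl = ⊥-elim (inj (All.lookup a x′∈) r r′)
  ... | inj₂ y′∈′ = y′ , y′∈′ , r′

Unique-length-≤ : {A : Set} {xs ys : List A} → Unique xs → (∀ {x} → x ∈ xs → x ∈ ys) →
                  length xs ≤ length ys
Unique-length-≤ {ys = ys} u ⊆ = pigeonhole _≡_ (λ x≢x′ e e′ → x≢x′ (trans e (sym e′)))
  ys u (λ x∈ → _ , ⊆ x∈ , refl)

count-tabulate : ∀ {n} {A : Set} {P : A → Set} (P? : ∀ x → Dec (P x)) (f : Fin n → A) →
                 Vec.count P? (Vec.tabulate f) ≡ length (filter P? (tabulate f))
count-tabulate {zero}  P? f = refl
count-tabulate {suc n} P? f with does (P? (f zero))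
... | true  = cong suc (count-tabulate P? (f ∘ suc))
... | false = count-tabulate P? (f ∘ suc)

-- Edges and paths of a graph.

module Walks (G : Graph) where

  V E : Set
  V = Fin (order G)
  E = Fin (size G)

  open DecMembership {A = E} Fin._≟_ using (_∈?_) public

  Joins : E → V → V → Set
  Joins e u v = Incident G u e × Incident G v e × u ≢ v

  private
    variable
      a b c d t u v w x y z : V
      e f g : E
      xs ys ls rs : List V

  joins? : ∀ e u v → Dec (Joins e u v)
  joins? e u v = incident? G u e ×-dec (incident? G v e ×-dec ¬? (u Fin.≟ v))

  joins-sym : Joins e u v → Joins e v u
  joins-sym (p , q , u≢v) = q , p , u≢v ∘ sym

  incident-joins : Joins e u v → Incident G w e → w ≡ u ⊎ w ≡ v
  incident-joins (inj₁ p , inj₁ q , u≢v) _        = ⊥-elim (u≢v (trans p (sym q)))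
  incident-joins (inj₁ p , inj₂ q , _)   (inj₁ r) = inj₁ (trans r (sym p))
  incident-joins (inj₁ p , inj₂ q , _)   (inj₂ r) = inj₂ (trans r (sym q))
  incident-joins (inj₂ p , inj₁ q , _)   (inj₁ r) = inj₂ (trans r (sym q))
  incident-joins (inj₂ p , inj₁ q , _)   (inj₂ r) = inj₁ (trans r (sym p))
  incident-joins (inj₂ p , inj₂ q , u≢v) _        = ⊥-elim (u≢v (trans p (sym q)))

  miss : Joins e u v → Incident G w f → w ≢ u → w ≢ v → e ≢ f
  miss j i w≢u w≢v refl = [ w≢u , w≢v ]′ (incident-joins j i)

  joins-unique : Joins e u v → Joins e u w → v ≡ w
  joins-unique j (_ , i , u≢w) with incident-joins j i
  ... | inj₁ w≡u = ⊥-elim (u≢w (sym w≡u))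
  ... | inj₂ w≡v = sym w≡v

  otherEnd : ∀ {e u} → Incident G u e → ∃[ v ] Joins e u v
  otherEnd {e} (inj₁ p) = _ , inj₁ p , inj₂ refl , λ q → loopless G e (trans (sym p) q)
  otherEnd {e} (inj₂ p) = _ , inj₂ p , inj₁ refl , λ q → loopless G e (trans (sym q) p)

  -- Repeated vertices are not excluded here. Simplicity is a separate `Unique` hypothesis on the
  -- index, obtained from the cover, so that paths can be cut and glued without carrying proofs
  -- along.
  data Path : V → V → List V → Set where
    stop : ∀ v → Path v v (v ∷ [])
    step : ∀ {u v t xs} e → Joins e u v → Path v t xs → Path u t (u ∷ xs)

  edgesOf : Path a b xs → List E
  edgesOf (stop _)     = []
  edgesOf (step e _ p) = e ∷ edgesOf p

  append : Path a b xs → Joins e b c → Path c d ys → Path a d (xs ++ ys)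
  append (stop _)     k q = step _ k q
  append (step e j p) k q = step e j (append p k q)

  reversePath : Path a b xs → ∃[ ys ] Path b a ys × ys ↭ xs
  reversePath (stop v) = _ , stop v , refl
  reversePath {a} (step e j p) with reversePath p
  ... | ys , q , r = _ , append q (joins-sym j) (stop a) , ↭-trans (++-comm ys (a ∷ [])) (prep a r)

  start∈ : Path a b xs → a ∈ xs
  start∈ (stop _)     = here refl
  start∈ (step _ _ _) = here refl

  end∈ : Path a b xs → b ∈ xs
  end∈ (stop _)     = here refl
  end∈ (step _ _ p) = there (end∈ p)

  nonempty : Path a b xs → 1 ≤ length xs
  nonempty (stop _)     = s≤s z≤n
  nonempty (step _ _ _) = s≤s z≤n

  edges⊆ : (p : Path a b xs) → g ∈ edgesOf p → Incident G w g → w ∈ xs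
  edges⊆ (step e j p) (here refl) i with incident-joins j i
  ... | inj₁ refl = here refl
  ... | inj₂ refl = there (start∈ p)
  edges⊆ (step e j p) (there g∈) i = there (edges⊆ p g∈ i)

  edge-at-start : (p : Path a b xs) → Unique xs → f ∈ edgesOf p → g ∈ edgesOf p →
                  Incident G a f → Incident G a g → f ≡ g
  edge-at-start (step e j p) _       (here refl) (here refl) _ _ = refl
  edge-at-start (step e j p) (n ∷ _) (there f∈)  _           i _ =
    ⊥-elim (All.lookup n (edges⊆ p f∈ i) refl)
  edge-at-start (step e j p) (n ∷ _) (here _)    (there g∈)  _ i =
    ⊥-elim (All.lookup n (edges⊆ p g∈ i) refl)

  private
    -- The end `b` cannot be `u`, which does not recur, so it is `v`; and a simple path from `v` to
    -- `v` has no edges.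
    edge-at-end-step : (j : Joins e u v) (p : Path v b xs) → Unique (u ∷ xs) →
                       Incident G b e → g ∉ edgesOf p
    edge-at-end-step j p (n ∷ un) i g∈ with incident-joins j i
    ... | inj₁ refl = All.lookup n (end∈ p) refl
    edge-at-end-step j (stop _) (n ∷ un) i () | inj₂ refl
    edge-at-end-step j (step _ _ p) (n ∷ n′ ∷ un) i g∈ | inj₂ refl = All.lookup n′ (end∈ p) refl

  edge-at-end : (p : Path a b xs) → Unique xs → f ∈ edgesOf p → g ∈ edgesOf p →
                Incident G b f → Incident G b g → f ≡ g
  edge-at-end (step e j p) un       (here refl) (here refl) _ _ = refl
  edge-at-end (step e j p) un       (here refl) (there g∈)  i _ = ⊥-elim (edge-at-end-step j p un i g∈)
  edge-at-end (step e j p) un       (there f∈)  (here refl) _ i = ⊥-elim (edge-at-end-step j p un i f∈)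
  edge-at-end (step e j p) (_ ∷ un) (there f∈)  (there g∈)  i k = edge-at-end p un f∈ g∈ i k

  -- The two pieces left by deleting `x` are kept as paths for the exchange arguments, and the two
  -- path edges at `x` for counting degrees.
  record Inside (p : Path a b xs) (x : V) : Set where
    field
      {pred succ}   : V
      {before after} : List V
      {inEdge outEdge} : E
      left    : Path a pred before
      into    : Joins inEdge pred x
      outof   : Joins outEdge x succ
      right   : Path succ b after
      splits  : xs ≡ before ++ x ∷ after
      in∈     : inEdge ∈ edgesOf p
      out∈    : outEdge ∈ edgesOf p

  open Inside public

  place : (p : Path a b xs) → x ∈ xs → x ≡ a ⊎ x ≡ b ⊎ Inside p x
  place (stop _)     (here refl) = inj₁ refl
  place (step _ _ _) (here refl) = inj₁ refl
  place (step e j p) (there x∈) with place p x∈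
  place (step e j (stop _))       (there x∈) | inj₁ refl = inj₂ (inj₁ refl)
  place (step e j (step f k p))   (there x∈) | inj₁ refl = inj₂ (inj₂ (record
    { left = stop _ ; into = j ; outof = k ; right = p ; splits = refl
    ; in∈ = here refl ; out∈ = there (here refl) }))
  ... | inj₂ (inj₁ x≡b) = inj₂ (inj₁ x≡b)
  ... | inj₂ (inj₂ i) = inj₂ (inj₂ (record
    { left = step e j (left i) ; into = into i ; outof = outof i ; right = right i
    ; splits = cong (_ ∷_) (splits i) ; in∈ = there (in∈ i) ; out∈ = there (out∈ i) }))

  inside∈ : {p : Path a b xs} → Inside p x → x ∈ xs
  inside∈ {x = x} i = subst (x ∈_) (sym (splits i)) (∈-++⁺ʳ (before i) (here refl))

  module _ {p : Path a b xs} (un : Unique xs) (i : Inside p x) where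

    private
      parts = Unique-++⁻ (before i) (subst Unique (splits i) un)

    inside≢start : x ≢ a
    inside≢start refl = proj₂ (proj₂ parts) (start∈ (left i)) (here refl)

    inside≢end : x ≢ b
    inside≢end refl with proj₁ (proj₂ parts)
    ... | n ∷ _ = All.lookup n (end∈ (right i)) refl

    pred≢succ : pred i ≢ succ i
    pred≢succ e = proj₂ (proj₂ parts) (end∈ (left i))
      (there (subst (_∈ after i) (sym e) (start∈ (right i))))

    in≢out : inEdge i ≢ outEdge i
    in≢out e = pred≢succ (joins-unique (joins-sym (into i))
      (subst (λ h → Joins h x (succ i)) (sym e) (outof i)))

  -- Components of a cover and their kinds.

  record Comp : Set where
    constructor comp
    field
      {start end} : V
      {verts}     : List V
      path        : Path start end verts

  open Comp public

  ∣_∣ᶜ : Comp → ℕ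
  ∣ P ∣ᶜ = length (verts P)

  -- The last condition matters for two vertices: the edge of the path does not close it, but a
  -- parallel edge makes it a cycle of length two.
  Closing : Comp → Set
  Closing P = ∃[ e ] Joins e (start P) (end P) × e ∉ edgesOf (path P)

  closing? : ∀ P → Dec (Closing P)
  closing? P = Fin.any? λ e → joins? e (start P) (end P) ×-dec ¬? (e ∈? edgesOf (path P))

  -- This is the color due for an edge that follows the path, not the color of its last edge; a
  -- closing edge can receive it.
  colourAfter : Fin 2 → Path a b xs → Fin 2
  colourAfter c (stop _)     = c
  colourAfter c (step _ _ p) = colourAfter (opposite c) p

  -- Triangles are grouped with isolated vertices because both are only sure to own four vertices,
  -- one too few, and have to be compensated by open paths.
  data Kind : Set where
    even short long odd : Kind

  _≟ᵏ_ : (k l : Kind) → Dec (k ≡ l)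
  even  ≟ᵏ even  = yes refl
  even  ≟ᵏ short = no λ ()
  even  ≟ᵏ long  = no λ ()
  even  ≟ᵏ odd   = no λ ()
  short ≟ᵏ even  = no λ ()
  short ≟ᵏ short = yes refl
  short ≟ᵏ long  = no λ ()
  short ≟ᵏ odd   = no λ ()
  long  ≟ᵏ even  = no λ ()
  long  ≟ᵏ short = no λ ()
  long  ≟ᵏ long  = yes refl
  long  ≟ᵏ odd   = no λ ()
  odd   ≟ᵏ even  = no λ ()
  odd   ≟ᵏ short = no λ ()
  odd   ≟ᵏ long  = no λ ()
  odd   ≟ᵏ odd   = yes refl

  -- A path with a closing edge stands for a cycle.  It is an even cycle
  -- precisely when an alternating coloring starting with zero leaves the
  -- other color for the closing edge.
  data Class (P : Comp) : Kind → Set where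
    evenCycle : Closing P → colourAfter zero (path P) ≡ suc zero → 2 ≤ ∣ P ∣ᶜ → Class P even
    triangle  : Closing P → ∣ P ∣ᶜ ≡ 3 → Class P short
    single    : ∣ P ∣ᶜ ≡ 1 → Class P short
    openPath  : ¬ Closing P → 2 ≤ ∣ P ∣ᶜ → Class P long
    oddCycle  : Closing P → 5 ≤ ∣ P ∣ᶜ → Class P odd

  classify : ∀ P → ∃ (Class P)
  classify P@(comp (stop _)) = _ , single refl
  classify P@(comp (step _ _ p)) with closing? P
  ... | no ¬c = _ , openPath ¬c (s≤s (nonempty p))
  classify (comp (step _ _ (stop _))) | yes c = _ , evenCycle c refl (s≤s (s≤s z≤n))
  classify (comp (step _ _ (step _ _ (stop _)))) | yes c = _ , triangle c refl
  classify (comp (step _ _ (step _ _ (step _ _ (stop _))))) | yes c =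
    _ , evenCycle c refl (s≤s (s≤s z≤n))
  -- Closed paths with up to four vertices are settled above, so a failing color test leaves at
  -- least five.
  classify P@(comp (step _ _ (step _ _ (step _ _ (step _ _ p))))) | yes c
    with colourAfter zero (path P) Fin.≟ suc zero
  ... | yes q = _ , evenCycle c q (s≤s (s≤s z≤n))
  ... | no _  = _ , oddCycle c (s≤s (s≤s (s≤s (s≤s (nonempty p)))))

  kind : Comp → Kind
  kind P = proj₁ (classify P)

  class : ∀ P → Class P (kind P)
  class P = proj₂ (classify P)

  -- Coloring a cover with two colors.

  cost : Kind → ℕ
  cost even = 0
  cost _    = 1

  Colouring : Set
  Colouring = List (E × Fin 2)

  Compatible : E × Fin 2 → E × Fin 2 → Set
  Compatible (e , c) (f , d) = e ≢ f × (c ≡ d → ∀ {v} → Incident G v e → Incident G v f → ⊥)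

  private
    opposite≢ : (c : Fin 2) → opposite c ≢ c
    opposite≢ zero       ()
    opposite≢ (suc zero) ()

  alternate : Fin 2 → Path a b xs → Colouring
  alternate c (stop _)     = []
  alternate c (step e _ p) = (e , c) ∷ alternate (opposite c) p

  alternate⊆ : ∀ {c h} (p : Path a b xs) → h ∈ alternate c p → proj₁ h ∈ edgesOf p
  alternate⊆ (step e _ p) (here refl) = here refl
  alternate⊆ (step e _ p) (there h∈)  = there (alternate⊆ p h∈)

  alternate-length : ∀ c (p : Path a b xs) → suc (length (alternate c p)) ≡ length xs
  alternate-length c (stop _)     = refl
  alternate-length c (step e _ p) = cong suc (alternate-length (opposite c) p)

  alternate-start : ∀ {c h} (p : Path a b xs) → Unique xs → h ∈ alternate c p →
                    proj₂ h ≢ c → ¬ Incident G a (proj₁ h)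
  alternate-start (step e j p) _       (here refl) d≢c _ = d≢c refl
  alternate-start (step e j p) (n ∷ _) (there h∈)  _   i =
    All.lookup n (edges⊆ p (alternate⊆ p h∈) i) refl

  -- Only the last edge meets `b`, and its color is opposite to the one due next.
  alternate-end : ∀ {c h} (p : Path a b xs) → Unique xs → h ∈ alternate c p →
                  proj₂ h ≡ colourAfter c p → ¬ Incident G b (proj₁ h)
  alternate-end (step e j p) (_ ∷ un) (there h∈) q i = alternate-end p un h∈ q i
  alternate-end (step e j p) (n ∷ un) (here refl) q i with incident-joins j i
  ... | inj₁ refl = All.lookup n (end∈ p) refl
  alternate-end (step e j (stop _)) _ (here refl) q i | inj₂ refl = opposite≢ _ (sym q)
  alternate-end (step e j (step _ _ p)) (_ ∷ n ∷ _) (here refl) q i | inj₂ refl =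
    All.lookup n (end∈ p) refl

  alternate-compatible : ∀ c (p : Path a b xs) → Unique xs → AllPairs Compatible (alternate c p)
  alternate-compatible c (stop _)     _        = []
  alternate-compatible c (step e j p) (n ∷ un) =
    All.tabulate (λ h∈ → apart h∈ , λ q i k → clash h∈ q (incident-joins j i) k) ∷
    alternate-compatible (opposite c) p un
    where
    apart : ∀ {h} → h ∈ alternate (opposite c) p → e ≢ proj₁ h
    apart h∈ refl = All.lookup n (edges⊆ p (alternate⊆ p h∈) (proj₁ j)) refl
    clash : ∀ {h v} → h ∈ alternate (opposite c) p → c ≡ proj₂ h → _ → ¬ Incident G v (proj₁ h)
    clash h∈ q (inj₁ refl) k = All.lookup n (edges⊆ p (alternate⊆ p h∈) k) refl
    clash h∈ q (inj₂ refl) k = alternate-start p un h∈ (λ r → opposite≢ c (sym (trans q r))) k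

  colourBy : ∀ {k} P → Class P k → Colouring
  colourBy P (evenCycle (e , _) _ _) = (e , suc zero) ∷ alternate zero (path P)
  colourBy P _                       = alternate zero (path P)

  private
    alternate-end∈ : ∀ {c h v} (p : Path a b xs) → h ∈ alternate c p →
                     Incident G v (proj₁ h) → v ∈ xs
    alternate-end∈ p h∈ = edges⊆ p (alternate⊆ p h∈)

  colourBy⊆ : ∀ {k h v} P (C : Class P k) → h ∈ colourBy P C → Incident G v (proj₁ h) → v ∈ verts P
  colourBy⊆ P (evenCycle (e , j , _) _ _) (here refl) i with incident-joins j i
  ... | inj₁ refl = start∈ (path P)
  ... | inj₂ refl = end∈ (path P)
  colourBy⊆ P (evenCycle _ _ _) (there h∈) = alternate-end∈ (path P) h∈
  colourBy⊆ P (triangle _ _)    h∈         = alternate-end∈ (path P) h∈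
  colourBy⊆ P (single _)        h∈         = alternate-end∈ (path P) h∈
  colourBy⊆ P (openPath _ _)    h∈         = alternate-end∈ (path P) h∈
  colourBy⊆ P (oddCycle _ _)    h∈         = alternate-end∈ (path P) h∈

  colourBy-length : ∀ {k} P (C : Class P k) → length (colourBy P C) + cost k ≡ ∣ P ∣ᶜ
  colourBy-length P (evenCycle _ _ _) = trans (ℕ.+-identityʳ _) (alternate-length zero (path P))
  colourBy-length P (triangle _ _)    = trans (ℕ.+-comm _ 1) (alternate-length zero (path P))
  colourBy-length P (single _)        = trans (ℕ.+-comm _ 1) (alternate-length zero (path P))
  colourBy-length P (openPath _ _)    = trans (ℕ.+-comm _ 1) (alternate-length zero (path P))
  colourBy-length P (oddCycle _ _)    = trans (ℕ.+-comm _ 1) (alternate-length zero (path P))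

  colourBy-compatible : ∀ {k} P (C : Class P k) → Unique (verts P) →
                        AllPairs Compatible (colourBy P C)
  colourBy-compatible P (evenCycle (e , j , e∉) q _) un =
    All.tabulate (λ h∈ → (λ { refl → e∉ (alternate⊆ (path P) h∈) }) ,
      λ r i → clash h∈ r (incident-joins j i)) ∷ alternate-compatible zero (path P) un
    where
    clash : ∀ {h v} → h ∈ alternate zero (path P) → suc zero ≡ proj₂ h → _ →
            ¬ Incident G v (proj₁ h)
    clash h∈ r (inj₁ refl) = alternate-start (path P) un h∈ (λ s → contradiction (trans r s) λ ())
    clash h∈ r (inj₂ refl) = alternate-end (path P) un h∈ (trans (sym r) (sym q))
  colourBy-compatible P (triangle _ _) un = alternate-compatible zero (path P) un
  colourBy-compatible P (single _)     un = alternate-compatible zero (path P) un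
  colourBy-compatible P (openPath _ _) un = alternate-compatible zero (path P) un
  colourBy-compatible P (oddCycle _ _) un = alternate-compatible zero (path P) un

  allVerts : List Comp → List V
  allVerts = concatMap verts

  total : (Kind → ℕ) → List Comp → ℕ
  total f []       = 0
  total f (P ∷ ps) = f (kind P) + total f ps

  colourAll : List Comp → Colouring
  colourAll = concatMap λ P → colourBy P (class P)

  colourAll⊆ : ∀ {h v} ps → h ∈ colourAll ps → Incident G v (proj₁ h) → v ∈ allVerts ps
  colourAll⊆ (P ∷ ps) h∈ i with ∈-++⁻ (colourBy P (class P)) h∈
  ... | inj₁ h∈′ = ∈-++⁺ˡ (colourBy⊆ P (class P) h∈′ i)
  ... | inj₂ h∈′ = ∈-++⁺ʳ (verts P) (colourAll⊆ ps h∈′ i)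

  colourAll-length : ∀ ps → length (colourAll ps) + total cost ps ≡ length (allVerts ps)
  colourAll-length []       = refl
  colourAll-length (P ∷ ps) = begin
    length (m ++ colourAll ps) + (cost (kind P) + total cost ps)
      ≡⟨ cong (_+ (cost (kind P) + total cost ps)) (length-++ m) ⟩
    (length m + length (colourAll ps)) + (cost (kind P) + total cost ps)
      ≡⟨ interchange ℕ.+-commutativeSemigroup (length m) _ _ _ ⟩
    (length m + cost (kind P)) + (length (colourAll ps) + total cost ps)
      ≡⟨ cong₂ _+_ (colourBy-length P (class P)) (colourAll-length ps) ⟩
    length (verts P) + length (allVerts ps)
      ≡⟨ sym (length-++ (verts P)) ⟩
    length (allVerts (P ∷ ps)) ∎
    where
    open ≡-Reasoning
    m = colourBy P (class P)

  colourAll-compatible : ∀ ps → Unique (allVerts ps) → AllPairs Compatible (colourAll ps)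
  colourAll-compatible []       _  = []
  colourAll-compatible (P ∷ ps) un with Unique-++⁻ (verts P) un
  ... | u₁ , u₂ , disjoint = AllPairs.++⁺ (colourBy-compatible P (class P) u₁)
    (colourAll-compatible ps u₂)
    (All.tabulate λ {h} h∈ → All.tabulate λ k∈ →
      (λ { refl → meet h∈ k∈ (inj₁ refl) (inj₁ refl) }) , λ _ → meet h∈ k∈)
    where
    meet : ∀ {h k v} → h ∈ colourBy P (class P) → k ∈ colourAll ps →
           Incident G v (proj₁ h) → Incident G v (proj₁ k) → ⊥
    meet h∈ k∈ i i′ = disjoint (colourBy⊆ P (class P) h∈ i) (colourAll⊆ ps k∈ i′)

  support : Colouring → Subset (size G)
  support []            = Subset.⊥
  support ((e , _) ∷ m) = ⁅ e ⁆ ∪ support m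

  support⁻ : ∀ m → e Subset.∈ support m → ∃[ c ] (e , c) ∈ m
  support⁻ []            e∈ = ⊥-elim (∉⊥ e∈)
  support⁻ ((f , c) ∷ m) e∈ with x∈p∪q⁻ ⁅ f ⁆ (support m) e∈
  ... | inj₁ e∈f with refl ← x∈⁅y⁆⇒x≡y f e∈f = c , here refl
  ... | inj₂ e∈m with support⁻ m e∈m
  ... | d , h∈ = d , there h∈

  length≤∣support∣ : ∀ {m} → AllPairs Compatible m → length m ≤ ∣ support m ∣
  length≤∣support∣ []                                = z≤n
  length≤∣support∣ {(e , _) ∷ m} (compatible ∷ rest) =
    ℕ.≤-<-trans (length≤∣support∣ rest)
      (p⊂q⇒∣p∣<∣q∣ (q⊆p∪q ⁅ e ⁆ (support m) , e , p⊆p∪q (support m) (x∈⁅x⁆ e) , fresh))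
    where
    fresh : e Subset.∉ support m
    fresh e∈ with support⁻ m e∈
    ... | _ , h∈ = proj₁ (All.lookup compatible h∈) refl

  length≤ν₂ : ∀ {m} → AllPairs Compatible m → length m ≤ ν 2 G
  length≤ν₂ {m} compatible = ℕ.≤-trans (length≤∣support∣ compatible)
    (proj₂ (proj₂ (maximumColorable G 2)) (spanning G (support m) , colouring , refl))
    where
    colouring : EdgeColorable G 2 (spanning G (support m))
    colouring = (λ (_ , e∈) → proj₁ (support⁻ m e∈)) , λ (e , e∈) (f , f∈) (e≢f , v , i , k) q →
      clash compatible (proj₂ (support⁻ m e∈)) (proj₂ (support⁻ m f∈)) e≢f q i k
      where
      clash : ∀ {m e f c d v} → AllPairs Compatible m → (e , c) ∈ m → (f , d) ∈ m → e ≢ f →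
              c ≡ d → Incident G v e → Incident G v f → ⊥
      clash (_ ∷ _)  (here refl) (here refl) e≢f _ _ _ = e≢f refl
      clash (cs ∷ _) (here refl) (there f∈) _ q i k = proj₂ (All.lookup cs f∈) q i k
      clash (cs ∷ _) (there e∈) (here refl) _ q i k = proj₂ (All.lookup cs e∈) (sym q) k i
      clash (_ ∷ cs) (there e∈) (there f∈) e≢f q i k = clash cs e∈ f∈ e≢f q i k

  -- Rearranging components, exposed vertices and weights.

  allVerts-↭ : ∀ {ps qs} → ps ↭ qs → allVerts ps ↭ allVerts qs
  allVerts-↭ refl       = refl
  allVerts-↭ (prep P p) = ++⁺ˡ (verts P) (allVerts-↭ p)
  allVerts-↭ (swap {ps} {qs} P Q p) = ↭-trans (++⁺ˡ (verts P) (++⁺ˡ (verts Q) (allVerts-↭ p)))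
    (shifts (verts P) (verts Q))
  allVerts-↭ (_↭_.trans p q) = ↭-trans (allVerts-↭ p) (allVerts-↭ q)

  allVerts⁻ : ∀ {v} ps → v ∈ allVerts ps → ∃[ P ] P ∈ ps × v ∈ verts P
  allVerts⁻ (P ∷ ps) v∈ with ∈-++⁻ (verts P) v∈
  ... | inj₁ v∈P = P , here refl , v∈P
  ... | inj₂ v∈ps with allVerts⁻ ps v∈ps
  ... | Q , Q∈ , v∈Q = Q , there Q∈ , v∈Q

  allVerts⁺ : ∀ {v P ps} → P ∈ ps → v ∈ verts P → v ∈ allVerts ps
  allVerts⁺          (here refl) v∈ = ∈-++⁺ˡ v∈
  allVerts⁺ {ps = Q ∷ _} (there P∈)  v∈ = ∈-++⁺ʳ (verts Q) (allVerts⁺ P∈ v∈)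

  total-++ : ∀ f ps {qs} → total f (ps ++ qs) ≡ total f ps + total f qs
  total-++ f []       = refl
  total-++ f (P ∷ ps) = trans (cong (λ n → f (kind P) + n) (total-++ f ps)) (sym (ℕ.+-assoc (f (kind P)) _ _))

  total-↭ : ∀ f {ps qs} → ps ↭ qs → total f ps ≡ total f qs
  total-↭ f refl           = refl
  total-↭ f (prep P p)     = cong (λ n → f (kind P) + n) (total-↭ f p)
  total-↭ f (swap {ps} P Q p) = trans (cong (λ n → f (kind P) + (f (kind Q) + n)) (total-↭ f p))
    (x∙yz≈y∙xz ℕ.+-commutativeSemigroup (f (kind P)) (f (kind Q)) _)
  total-↭ f (_↭_.trans p q) = trans (total-↭ f p) (total-↭ f q)

  Tip : Comp → V → Set
  Tip P u = ∃[ a ] ∃[ xs ] Path a u xs × xs ↭ verts P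

  Exposed : Comp → V → Set
  Exposed P x = x ≡ start P ⊎ x ≡ end P ⊎ Closing P

  Hidden : Comp → V → Set
  Hidden P x = ¬ Closing P × Inside (path P) x

  private
    endTip : ∀ P → Tip P (end P)
    endTip P = _ , _ , path P , refl

    startTip : ∀ P → Tip P (start P)
    startTip P with reversePath (path P)
    ... | _ , p , r = _ , _ , p , r

  -- A cycle is cut open at an inner vertex `x`: run from the successor of `x` to the end, over the
  -- closing edge to the start, and on to `x`.
  tip : ∀ P → x ∈ verts P → Exposed P x → Tip P x
  tip P x∈ (inj₁ refl)        = startTip P
  tip P x∈ (inj₂ (inj₁ refl)) = endTip P
  tip P x∈ (inj₂ (inj₂ (_ , j , _))) with place (path P) x∈
  ... | inj₁ refl        = startTip P
  ... | inj₂ (inj₁ refl) = endTip P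
  ... | inj₂ (inj₂ i)    = _ , _ ,
    append (append (right i) (joins-sym j) (left i)) (into i) (stop _) ,
    subst (_ ↭_) (sym (splits i))
      (↭-trans (++-comm (after i ++ before i) (_ ∷ []))
        (↭-trans (prep _ (++-comm (after i) (before i))) (↭-sym (shift _ (before i) (after i)))))

  short⇒exposed : ∀ P → Class P short → x ∈ verts P → Exposed P x
  short⇒exposed P                      (triangle c _) _           = inj₂ (inj₂ c)
  short⇒exposed (comp (stop _))        (single _)     (here refl) = inj₁ refl
  short⇒exposed (comp (step _ _ (stop _)))     (single ()) _
  short⇒exposed (comp (step _ _ (step _ _ _))) (single ()) _

  inside-length : {p : Path a b xs} → Inside p x → 3 ≤ length xs
  inside-length i = subst (3 ≤_)
    (sym (trans (cong length (splits i)) (trans (length-++ (before i)) (ℕ.+-suc _ _))))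
    (s≤s (ℕ.+-mono-≤ (nonempty (left i)) (nonempty (right i))))

  hidden⇒long : ∀ {k} P → Class P k → Hidden P x → k ≡ long
  hidden⇒long P (evenCycle c _ _) (¬c , _) = ⊥-elim (¬c c)
  hidden⇒long P (triangle c _)    (¬c , _) = ⊥-elim (¬c c)
  hidden⇒long P (single l)        (_ , i)  =
    ⊥-elim (ℕ.<⇒≱ (s≤s (s≤s z≤n)) (subst (3 ≤_) l (inside-length i)))
  hidden⇒long P (openPath _ _)    _        = refl
  hidden⇒long P (oddCycle c _)    (¬c , _) = ⊥-elim (¬c c)

  -- Chosen so that each of the following lowers the total: merging two
  -- paths, absorbing an even cycle into a path, and attaching a short component
  -- to a long path that is cut so that the piece left over is not short.
  weight : Kind → ℕ
  weight even  = 1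
  weight short = 3
  weight long  = 2
  weight odd   = 2

  weight-positive : ∀ k → 1 ≤ weight k
  weight-positive even  = s≤s z≤n
  weight-positive short = s≤s z≤n
  weight-positive long  = s≤s z≤n
  weight-positive odd   = s≤s z≤n

  weight-light : ∀ {k} → k ≢ short → weight k ≤ 2
  weight-light {even}  _ = s≤s z≤n
  weight-light {short} k≢ = ⊥-elim (k≢ refl)
  weight-light {long}  _ = ℕ.≤-refl
  weight-light {odd}   _ = ℕ.≤-refl

  weight-costly : ∀ {k} → k ≢ even → 2 ≤ weight k
  weight-costly {even}  k≢ = ⊥-elim (k≢ refl)
  weight-costly {short} _ = s≤s (s≤s z≤n)
  weight-costly {long}  _ = ℕ.≤-refl
  weight-costly {odd}   _ = ℕ.≤-refl

  short-size : ∀ {P} → Class P short → ∣ P ∣ᶜ ≤ 3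
  short-size (triangle _ l) = ℕ.≤-reflexive l
  short-size (single l)     = ℕ.≤-trans (ℕ.≤-reflexive l) (s≤s z≤n)

  -- If `R` is not short it weighs at most 2, against at least 2 + 1 before. If `R` is short it
  -- weighs 3 but has at most three vertices. This excludes an odd cycle as `P`, and an open path
  -- with an even cycle; the remaining pairs weigh at least 4.
  join-weight : ∀ {P Q R k l m} → Class P k → Class Q l → Class R m → k ≢ even →
                ∣ R ∣ᶜ ≡ ∣ P ∣ᶜ + ∣ Q ∣ᶜ → weight m < weight k + weight l
  join-weight {P} {Q} {R} {k} {l} {m} cP cQ cR k≢ eq with m ≟ᵏ short
  ... | no m≢    = ℕ.≤-trans (s≤s (weight-light m≢)) (ℕ.+-mono-≤ (weight-costly k≢) (weight-positive l))
  ... | yes refl = small k≢ cP cQ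
    where
    large : 4 ≤ ∣ P ∣ᶜ + ∣ Q ∣ᶜ → ⊥
    large h = ℕ.<⇒≱ h (subst (_≤ 3) eq (short-size cR))
    small : ∀ {k l} → k ≢ even → Class P k → Class Q l → 3 < weight k + weight l
    small {l = l} _ (triangle _ _) _ = ℕ.+-monoʳ-≤ 3 (weight-positive l)
    small {l = l} _ (single _)     _ = ℕ.+-monoʳ-≤ 3 (weight-positive l)
    small _ (oddCycle _ h)    _ = ⊥-elim (large (ℕ.≤-trans (ℕ.≤-trans (ℕ.n≤1+n 4) h) (ℕ.m≤m+n _ _)))
    small k≢ (evenCycle _ _ _) _ = ⊥-elim (k≢ refl)
    small _ (openPath _ h)    (evenCycle _ _ h′) = ⊥-elim (large (ℕ.+-mono-≤ h h′))
    small _ (openPath _ _)    (triangle _ _)     = s≤s (s≤s (s≤s (s≤s z≤n)))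
    small _ (openPath _ _)    (single _)         = s≤s (s≤s (s≤s (s≤s z≤n)))
    small _ (openPath _ _)    (openPath _ _)     = s≤s (s≤s (s≤s (s≤s z≤n)))
    small _ (openPath _ _)    (oddCycle _ _)     = s≤s (s≤s (s≤s (s≤s z≤n)))

-- Edges at the vertices of a cubic graph.

module CubicWalks (G : Graph) (cubic : Cubic G) where

  open Walks G public

  incidentEdges : V → List E
  incidentEdges v = filter (incident? G v) (tabulate (λ e → e))

  incidentEdges-length : ∀ v → length (incidentEdges v) ≡ 3
  incidentEdges-length v = trans (sym (count-tabulate (incident? G v) (λ e → e))) (cubic v)

  incidentEdges-unique : ∀ v → Unique (incidentEdges v)
  incidentEdges-unique v = Unique.filter⁺ (incident? G v) (Unique.allFin⁺ (size G))

  noFourEdges : ∀ {v es} → Unique es → All (Incident G v) es → length es ≢ 4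
  noFourEdges {v} {es} un inc l with subst₂ _≤_ l (incidentEdges-length v)
    (Unique-length-≤ un (λ {e} e∈ → ∈-filter⁺ (incident? G v) (∈-tabulate⁺ e) (All.lookup inc e∈)))
  ... | s≤s (s≤s (s≤s ()))

  noFourNeighbours : ∀ {v e₁ e₂ e₃ e₄ x₁ x₂ x₃ x₄} → Unique (x₁ ∷ x₂ ∷ x₃ ∷ x₄ ∷ []) →
                     Joins e₁ v x₁ → Joins e₂ v x₂ → Joins e₃ v x₃ → Joins e₄ v x₄ → ⊥
  noFourNeighbours ((p ∷ q ∷ r ∷ []) ∷ (s ∷ t ∷ []) ∷ (u ∷ []) ∷ [] ∷ []) j₁ j₂ j₃ j₄ =
    noFourEdges
      ((d p j₁ j₂ ∷ d q j₁ j₃ ∷ d r j₁ j₄ ∷ []) ∷ (d s j₂ j₃ ∷ d t j₂ j₄ ∷ []) ∷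
       (d u j₃ j₄ ∷ []) ∷ [] ∷ [])
      (proj₁ j₁ ∷ proj₁ j₂ ∷ proj₁ j₃ ∷ proj₁ j₄ ∷ []) refl
    where
    d : ∀ {e f v x y} → x ≢ y → Joins e v x → Joins f v y → e ≢ f
    d x≢y j k refl = x≢y (joins-unique j k)

  threeEdges : ∀ v → ∃[ e ] ∃[ f ] ∃[ g ] (e ≢ f × e ≢ g × f ≢ g) ×
               Incident G v e × Incident G v f × Incident G v g
  threeEdges v with incidentEdges v in eq | incidentEdges-length v | incidentEdges-unique v
  ... | e ∷ f ∷ g ∷ [] | refl | (p ∷ q ∷ []) ∷ (r ∷ []) ∷ [] ∷ [] =
    e , f , g , (p , q , r) , inc (here refl) , inc (there (here refl)) , inc (there (there (here refl)))
    where
    inc : ∀ {h} → h ∈ e ∷ f ∷ g ∷ [] → Incident G v h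
    inc h∈ = proj₂ (∈-filter⁻ (incident? G v) {xs = tabulate (λ e → e)} (subst (_ ∈_) (sym eq) h∈))

  thirdEdge : ∀ v e f → ∃[ g ] Incident G v g × g ≢ e × g ≢ f
  thirdEdge v e f with threeEdges v
  ... | a , b , c , (a≢b , a≢c , b≢c) , ia , ib , ic
      with a Fin.≟ e | a Fin.≟ f | b Fin.≟ e | b Fin.≟ f
  ... | no p     | no q     | _        | _        = a , ia , p , q
  ... | _        | _        | no p     | no q     = b , ib , p , q
  ... | yes refl | _        | yes refl | _        = ⊥-elim (a≢b refl)
  ... | _        | yes refl | _        | yes refl = ⊥-elim (a≢b refl)
  ... | yes refl | _        | _        | yes refl = c , ic , a≢c ∘ sym , b≢c ∘ sym
  ... | _        | yes refl | yes refl | _        = c , ic , b≢c ∘ sym , a≢c ∘ sym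

  -- Meant for an end `v` of an open path, with `D` the edges of the path, at most one of which
  -- meets `v`.
  twoEdgesOutside : ∀ v {D : E → Set} → (∀ e → Dec (D e)) →
                    (∀ {e f} → Incident G v e → Incident G v f → D e → D f → e ≡ f) →
                    ∃[ e ] ∃[ f ] e ≢ f × Incident G v e × Incident G v f × ¬ D e × ¬ D f
  twoEdgesOutside v D? unique with threeEdges v
  ... | a , b , c , (a≢b , a≢c , b≢c) , ia , ib , ic with D? a | D? b
  ... | yes da | _      = b , c , b≢c , ib , ic , a≢b ∘ unique ia ib da , a≢c ∘ unique ia ic da
  ... | no ¬da | yes db = a , c , a≢c , ia , ic , ¬da , b≢c ∘ unique ib ic db
  ... | no ¬da | no ¬db = a , b , a≢b , ia , ib , ¬da , ¬db

  -- The triangle uses two of the three edges at each vertex. If the third edge at the first vertex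
  -- stays inside, it doubles a side and saturates both ends of that side, so the third edge at the
  -- remaining vertex has to leave.
  escape : ∀ {a b g xs} (p : Path a b xs) → length xs ≡ 3 → Unique xs → Joins g a b →
           g ∉ edgesOf p → ∃[ t ] ∃[ y ] ∃[ h ] t ∈ xs × y ∉ xs × Joins h t y
  escape {a} {c} {g} (step {v = b} e₁ j₁ (step e₂ j₂ (stop _))) _
    ((a≢b ∷ a≢c ∷ []) ∷ (b≢c ∷ []) ∷ [] ∷ []) jg g∉
    with thirdEdge a e₁ g
  ... | h , ih , h≢e₁ , h≢g with otherEnd ih
  ... | y , jh with y Fin.≟ b | y Fin.≟ c
  ... | no y≢b | no y≢c = a , y , h , here refl , outside , jh
    where
    outside : y ∉ a ∷ b ∷ c ∷ []
    outside (here refl)                 = proj₂ (proj₂ jh) refl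
    outside (there (here refl))         = y≢b refl
    outside (there (there (here refl))) = y≢c refl
  ... | yes refl | _ with thirdEdge c e₂ g
  ... | k , ik , k≢e₂ , k≢g with otherEnd ik
  ... | z , jk with z Fin.≟ a | z Fin.≟ b
  ... | no z≢a | no z≢b = c , z , k , there (there (here refl)) , outside , jk
    where
    outside : z ∉ a ∷ b ∷ c ∷ []
    outside (here refl)                 = z≢a refl
    outside (there (here refl))         = z≢b refl
    outside (there (there (here refl))) = proj₂ (proj₂ jk) refl
  ... | yes refl | _ = ⊥-elim (noFourEdges
    ((g∉ ∘ here ∘ sym ∷ h≢e₁ ∘ sym ∷ miss j₁ ik (a≢c ∘ sym) (b≢c ∘ sym) ∷ []) ∷
     (h≢g ∘ sym ∷ k≢g ∘ sym ∷ []) ∷ (miss jh ik (a≢c ∘ sym) (b≢c ∘ sym) ∷ []) ∷ [] ∷ [])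
    (proj₁ j₁ ∷ proj₁ jg ∷ ih ∷ proj₁ (proj₂ jk) ∷ []) refl)
  ... | _ | yes refl = ⊥-elim (noFourEdges
    ((miss j₁ (proj₁ (proj₂ j₂)) (a≢c ∘ sym) (b≢c ∘ sym) ∷ h≢e₁ ∘ sym ∷
      miss j₁ ik (a≢c ∘ sym) (b≢c ∘ sym) ∷ []) ∷
     (miss j₂ ih a≢b a≢c ∷ k≢e₂ ∘ sym ∷ []) ∷ (miss jh ik (a≢c ∘ sym) (b≢c ∘ sym) ∷ []) ∷ [] ∷ [])
    (proj₁ (proj₂ j₁) ∷ proj₁ j₂ ∷ proj₁ (proj₂ jh) ∷ proj₁ (proj₂ jk) ∷ []) refl)
  -- Here `h` is parallel to the closing edge `g`, so `a` and `c` are saturated and the edge at `b`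
  -- escapes.
  escape {a} {c} {g} (step {v = b} e₁ j₁ (step e₂ j₂ (stop _))) _
    ((a≢b ∷ a≢c ∷ []) ∷ (b≢c ∷ []) ∷ [] ∷ []) jg g∉
    | h , ih , h≢e₁ , h≢g | y , jh | no _ | yes refl with thirdEdge b e₁ e₂
  ... | k , ik , k≢e₁ , k≢e₂ with otherEnd ik
  ... | z , jk with z Fin.≟ a | z Fin.≟ c
  ... | no z≢a | no z≢c = b , z , k , there (here refl) , outside , jk
    where
    outside : z ∉ a ∷ b ∷ c ∷ []
    outside (here refl)                 = z≢a refl
    outside (there (here refl))         = proj₂ (proj₂ jk) refl
    outside (there (there (here refl))) = z≢c refl
  ... | yes refl | _ = ⊥-elim (noFourEdges
    ((g∉ ∘ here ∘ sym ∷ h≢e₁ ∘ sym ∷ k≢e₁ ∘ sym ∷ []) ∷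
     (h≢g ∘ sym ∷ miss jg ik (a≢b ∘ sym) b≢c ∷ []) ∷ (miss jh ik (a≢b ∘ sym) b≢c ∷ []) ∷ [] ∷ [])
    (proj₁ j₁ ∷ proj₁ jg ∷ ih ∷ proj₁ (proj₂ jk) ∷ []) refl)
  ... | _ | yes refl = ⊥-elim (noFourEdges
    ((g∉ ∘ there ∘ here ∘ sym ∷ miss j₂ ih a≢b a≢c ∷ k≢e₂ ∘ sym ∷ []) ∷
     (h≢g ∘ sym ∷ miss jg ik (a≢b ∘ sym) b≢c ∷ []) ∷ (miss jh ik (a≢b ∘ sym) b≢c ∷ []) ∷ [] ∷ [])
    (proj₁ (proj₂ j₂) ∷ proj₁ (proj₂ jg) ∷ proj₁ (proj₂ jh) ∷ proj₁ (proj₂ jk) ∷ []) refl)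

  -- If deleting either of two distinct vertices x and y of a path left only
  -- short pieces, the path would have five vertices, and the middle one
  -- would be adjacent to all the others.
  no-crossing : ∀ {x y z s p t ls rs ls′ rs′ e f g} → length ls ≡ 1 →
                Path s p ls′ → length ls′ ≡ 3 → 1 ≤ length rs′ → ls ++ x ∷ rs ≡ ls′ ++ y ∷ rs′ →
                (R : Path z t rs) → Class (comp R) short → Unique (ls ++ x ∷ rs) →
                Joins g s p → Joins e p y → Joins f x z → ⊥
  no-crossing {ls = _ ∷ []} {rs′ = _ ∷ _} _ (step _ _ (step _ _ (stop _))) _ _ refl
    (step _ _ (step _ _ (stop _))) (triangle (_ , jh , _) _)
    ((p ∷ _ ∷ q ∷ r ∷ _) ∷ (_ ∷ s ∷ t ∷ _) ∷ _ ∷ (u ∷ _) ∷ _) jg je jf =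
    noFourNeighbours ((p ∷ q ∷ r ∷ []) ∷ (s ∷ t ∷ []) ∷ (u ∷ []) ∷ [] ∷ [])
      (joins-sym jg) (joins-sym jf) je jh
  no-crossing {ls = _ ∷ []} {rs′ = _ ∷ _} _ (step _ _ (step _ _ (stop _))) _ _ refl
    (step _ _ (step _ _ (step _ _ (stop _)))) (triangle _ ()) _ _ _ _
  no-crossing {ls = _ ∷ []} {rs′ = _ ∷ _} _ (step _ _ (step _ _ (stop _))) _ _ refl
    (step _ _ (step _ _ (step _ _ (step _ _ _)))) (triangle _ ()) _ _ _ _
  no-crossing {ls = _ ∷ []} {rs′ = _ ∷ _} _ (step _ _ (step _ _ (stop _))) _ _ refl
    (step _ _ (step _ _ _)) (single ()) _ _ _ _
  no-crossing {ls = _ ∷ []} {rs′ = _ ∷ _} _ (step _ _ (step _ _ (step _ _ (stop _)))) () _ _ _ _ _ _ _ _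
  no-crossing {ls = _ ∷ []} {rs′ = _ ∷ _} _ (step _ _ (step _ _ (step _ _ (step _ _ _)))) () _ _ _ _ _ _ _ _

  -- Comparing costs with guaranteed numbers of owned vertices.

  allV : List V
  allV = tabulate (λ v → v)

  -- The number of vertices that `holding` guarantees; even cycles cost nothing and need none.
  capacity : Kind → ℕ
  capacity even  = 0
  capacity short = 4
  capacity long  = 6
  capacity odd   = 5

  ofKind : Kind → List Comp → List Comp
  ofKind k = filter (λ P → kind P ≟ᵏ k)

  -- Against five vertices per costly component, a short one is one behind, a long one is one ahead,
  -- and an odd one is exact.
  tally : ∀ ps → total cost ps ℕ.* 5 + length (ofKind long ps) ≤
                 total capacity ps + length (ofKind short ps)
  tally [] = z≤n
  tally (P ∷ ps) with kind P | tally ps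
  ... | even  | h = h
  ... | short | h rewrite ℕ.+-suc (total capacity ps) (length (ofKind short ps)) = ℕ.+-monoʳ-≤ 5 h
  ... | long  | h rewrite ℕ.+-suc (total cost ps ℕ.* 5) (length (ofKind long ps)) = ℕ.+-monoʳ-≤ 6 h
  ... | odd   | h = ℕ.+-monoʳ-≤ 5 h

  -- Exchange arguments in a cover of minimal weight.

  module Minimal (ps : List Comp) (cover : allVerts ps ↭ allV)
    (minimal : ∀ qs → allVerts qs ↭ allV → total weight ps ≤ total weight qs) where

    private
      variable
        P Q S T : Comp
        e f g : E
        t u v x y : V

    allVerts-unique : Unique (allVerts ps)
    allVerts-unique = Unique-resp-↭ (↭-sym cover) (Unique.allFin⁺ (order G))

    unique : P ∈ ps → Unique (verts P)
    unique {P} P∈ with select P∈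
    ... | _ , p , _ = proj₁ (Unique-++⁻ (verts P) (Unique-resp-↭ (allVerts-↭ p) allVerts-unique))

    locate : ∀ v → ∃[ P ] P ∈ ps × v ∈ verts P
    locate v = allVerts⁻ ps (∈-resp-↭ (↭-sym cover) (∈-tabulate⁺ v))

    share : P ∈ ps → Q ∈ ps → v ∈ verts P → v ∈ verts Q → P ≡ Q
    share {P} P∈ Q∈ v∈P v∈Q with selectTwo P∈ Q∈
    ... | inj₁ P≡Q = P≡Q
    ... | inj₂ (_ , p) = ⊥-elim (proj₂ (proj₂
      (Unique-++⁻ (verts P) (Unique-resp-↭ (allVerts-↭ p) allVerts-unique))) v∈P (∈-++⁺ˡ v∈Q))

    -- This is where minimality enters: the other components stay, and their weight cancels.
    replace : ∀ {rest} news → ps ↭ P ∷ Q ∷ rest → allVerts news ↭ verts P ++ verts Q →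
              weight (kind P) + weight (kind Q) ≤ total weight news
    replace {P} {Q} {rest} news p r = ℕ.+-cancelʳ-≤ (total weight rest) _ _
      (subst₂ _≤_ (trans (total-↭ weight p) (sym (ℕ.+-assoc (weight (kind P)) _ _)))
        (total-++ weight news) (minimal (news ++ rest) cover′))
      where
      cover′ : allVerts (news ++ rest) ↭ allV
      cover′ = ↭-trans (subst (_↭ verts P ++ (verts Q ++ allVerts rest))
        (sym (concatMap-++ verts news rest))
        (subst (allVerts news ++ allVerts rest ↭_) (++-assoc (verts P) _ _) (++⁺ʳ _ r)))
        (↭-trans (↭-sym (allVerts-↭ p)) cover)

    -- The edge would merge both components into one path, which is lighter by `join-weight`.
    tips-apart : ∀ {rest} → ps ↭ P ∷ Q ∷ rest → kind P ≢ even → Tip P u → Tip Q v → ¬ Joins e u v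
    tips-apart {P} {Q} p k≢ (_ , xs , pu , ru) (_ , ys , qv , rv) j with reversePath qv
    ... | zs , q , rz = ℕ.<⇒≱ (join-weight (class P) (class Q) (class R) k≢ lengths)
      (subst (weight (kind P) + weight (kind Q) ≤_) (ℕ.+-identityʳ _)
        (replace (R ∷ []) p (subst (_↭ _) (sym (++-identityʳ _)) perm)))
      where
      R = comp (append pu j q)
      perm : xs ++ zs ↭ verts P ++ verts Q
      perm = ++⁺ ru (↭-trans rz rv)
      lengths : ∣ R ∣ᶜ ≡ ∣ P ∣ᶜ + ∣ Q ∣ᶜ
      lengths = trans (↭-length perm) (length-++ (verts P))

    exposed-not-hidden : P ∈ ps → x ∈ verts P → Exposed P x → Q ∈ ps → ¬ Hidden Q x
    exposed-not-hidden P∈ x∈ ex Q∈ (¬c , i) with share P∈ Q∈ x∈ (inside∈ i)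
    ... | refl with ex
    ... | inj₁ x≡s        = inside≢start (unique P∈) i x≡s
    ... | inj₂ (inj₁ x≡e) = inside≢end (unique P∈) i x≡e
    ... | inj₂ (inj₂ c)   = ¬c c

    -- Closing edges of cycles are free as well; they join exposed vertices and so never give rise
    -- to a `Head`.
    Free : E → Set
    Free g = ∀ {P} → P ∈ ps → g ∉ edgesOf (path P)

    off-path⇒free : P ∈ ps → t ∈ verts P → Incident G t g → g ∉ edgesOf (path P) → Free g
    off-path⇒free P∈ t∈ i g∉ {Q} Q∈ g∈ with share P∈ Q∈ t∈ (edges⊆ (path Q) g∈ i)
    ... | refl = g∉ g∈

    -- These are the claims of the counting argument: `t` claims the interior vertex `x` of an open
    -- path.
    Head : V → V → Set
    Head t x = ∃[ Q ] Q ∈ ps × Hidden Q x × (∃[ g ] Free g × Joins g t x)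

    -- The two path edges at an inner vertex leave room for only one further edge.
    free-unique : Q ∈ ps → Hidden Q x → Free f → Free g → Incident G x f → Incident G x g → f ≡ g
    free-unique {Q} {x} {f} {g} Q∈ (_ , i) ff fg xf xg with f Fin.≟ g
    ... | yes f≡g = f≡g
    ... | no f≢g  = ⊥-elim (noFourEdges
      ((in≢out (unique Q∈) i ∷ off ff (in∈ i) ∷ off fg (in∈ i) ∷ []) ∷
       (off ff (out∈ i) ∷ off fg (out∈ i) ∷ []) ∷ (f≢g ∷ []) ∷ [] ∷ [])
      (proj₁ (proj₂ (into i)) ∷ proj₁ (outof i) ∷ xf ∷ xg ∷ []) refl)
      where
      off : ∀ {g h} → Free g → h ∈ edgesOf (path Q) → h ≢ g
      off fr h∈ refl = fr Q∈ h∈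

    head-unique : Head t x → Head u x → t ≡ u
    head-unique (Q , Q∈ , h , f , ff , jf) (_ , _ , _ , g , fg , jg)
      with free-unique Q∈ h ff fg (proj₁ (proj₂ jf)) (proj₁ (proj₂ jg))
    ... | refl = joins-unique (joins-sym jf) (joins-sym jg)

    heads-distinct : Head t x → Free f → Free g → Joins f t x → Joins g t y → f ≢ g → x ≢ y
    heads-distinct (Q , Q∈ , h , _) ff fg jf jg f≢g refl =
      f≢g (free-unique Q∈ h ff fg (proj₁ (proj₂ jf)) (proj₁ (proj₂ jg)))

    -- In another component `x` cannot be exposed, by `tips-apart`; what remains is the interior of
    -- an open path.
    neighbour : P ∈ ps → kind P ≢ even → t ∈ verts P → Exposed P t → Free g → Joins g t x →
                x ∈ verts P ⊎ Head t x
    neighbour {x = x} P∈ k≢ t∈ et fg j with locate x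
    ... | Q , Q∈ , x∈ with selectTwo P∈ Q∈
    ... | inj₁ refl = inj₁ x∈
    ... | inj₂ (_ , p) with closing? Q | place (path Q) x∈
    ... | yes c | _               = ⊥-elim (tips-apart p k≢ (tip _ t∈ et) (tip Q x∈ (inj₂ (inj₂ c))) j)
    ... | no _  | inj₁ x≡s        = ⊥-elim (tips-apart p k≢ (tip _ t∈ et) (tip Q x∈ (inj₁ x≡s)) j)
    ... | no _  | inj₂ (inj₁ x≡e) = ⊥-elim (tips-apart p k≢ (tip _ t∈ et) (tip Q x∈ (inj₂ (inj₁ x≡e))) j)
    ... | no ¬c | inj₂ (inj₂ i)   = inj₂ (Q , Q∈ , (¬c , i) , _ , fg , j)

    -- Owned vertices of the components.

    Owns : Comp → V → Set
    Owns P x = (x ∈ verts P × Exposed P x) ⊎ (∃[ t ] t ∈ verts P × Head t x)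

    -- A claimed vertex is hidden and therefore not exposed, so the two ways of owning do not mix; a
    -- vertex claimed twice has a single claimant by `head-unique`.
    owner-unique : P ∈ ps → Q ∈ ps → Owns P x → Owns Q x → ∃[ v ] v ∈ verts P × v ∈ verts Q
    owner-unique P∈ Q∈ (inj₁ (x∈P , _))  (inj₁ (x∈Q , _))  = _ , x∈P , x∈Q
    owner-unique P∈ Q∈ (inj₁ (x∈P , ex)) (inj₂ (_ , _ , R , R∈ , h , _)) =
      ⊥-elim (exposed-not-hidden P∈ x∈P ex R∈ h)
    owner-unique P∈ Q∈ (inj₂ (_ , _ , R , R∈ , h , _)) (inj₁ (x∈Q , ex)) =
      ⊥-elim (exposed-not-hidden Q∈ x∈Q ex R∈ h)
    owner-unique P∈ Q∈ (inj₂ (t , t∈P , h)) (inj₂ (u , u∈Q , k)) with head-unique h k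
    ... | refl = t , t∈P , u∈Q

    Holding : Comp → ℕ → Set
    Holding P n = ∃[ xs ] Unique xs × All (Owns P) xs × n ≤ length xs

    private
      exposed≢head : P ∈ ps → u ∈ verts P → Exposed P u → Head t x → u ≢ x
      exposed≢head P∈ u∈ eu (Q , Q∈ , h , _) refl = exposed-not-hidden P∈ u∈ eu Q∈ h

    -- At most one of the three edges at `t` lies on the path. Neither of two others leads to the
    -- opposite end, since it would close the path; so both reach hidden vertices, possibly of `P`
    -- itself.
    end-heads : P ∈ ps → kind P ≢ even → ¬ Closing P → t ≡ start P ⊎ t ≡ end P →
                ∃[ x ] ∃[ y ] x ≢ y × Head t x × Head t y
    end-heads {P} {t} P∈ k≢ ¬c te = heads
      where
      t∈ : t ∈ verts P
      t∈ = [ (λ { refl → start∈ (path P) }) , (λ { refl → end∈ (path P) }) ]′ te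
      et : Exposed P t
      et = [ inj₁ , inj₂ ∘ inj₁ ]′ te
      pathEdge-unique : t ≡ start P ⊎ t ≡ end P → ∀ {e f} → Incident G t e → Incident G t f →
                        e ∈ edgesOf (path P) → f ∈ edgesOf (path P) → e ≡ f
      pathEdge-unique (inj₁ refl) i k e∈ f∈ = edge-at-start (path P) (unique P∈) e∈ f∈ i k
      pathEdge-unique (inj₂ refl) i k e∈ f∈ = edge-at-end (path P) (unique P∈) e∈ f∈ i k
      free : ∀ {g} → Incident G t g → g ∉ edgesOf (path P) → Free g
      free = off-path⇒free P∈ t∈
      inner : ∀ {g x} → t ≡ start P ⊎ t ≡ end P → g ∉ edgesOf (path P) → Joins g t x →
              x ≡ start P ⊎ x ≡ end P ⊎ Inside (path P) x → Inside (path P) x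
      inner _           _  _ (inj₂ (inj₂ i))    = i
      inner (inj₁ refl) _  j (inj₁ refl)        = ⊥-elim (proj₂ (proj₂ j) refl)
      inner (inj₂ refl) g∉ j (inj₁ refl)        = ⊥-elim (¬c (_ , joins-sym j , g∉))
      inner (inj₁ refl) g∉ j (inj₂ (inj₁ refl)) = ⊥-elim (¬c (_ , j , g∉))
      inner (inj₂ refl) _  j (inj₂ (inj₁ refl)) = ⊥-elim (proj₂ (proj₂ j) refl)
      toHead : ∀ {g x} → g ∉ edgesOf (path P) → Joins g t x → Head t x
      toHead g∉ j with neighbour P∈ k≢ t∈ et (free (proj₁ j) g∉) j
      ... | inj₁ x∈ = P , P∈ , (¬c , inner te g∉ j (place (path P) x∈)) , _ , free (proj₁ j) g∉ , j
      ... | inj₂ h  = h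
      heads : ∃[ x ] ∃[ y ] x ≢ y × Head t x × Head t y
      heads with twoEdgesOutside t (_∈? edgesOf (path P)) (pathEdge-unique te)
      ... | f , g , f≢g , itf , itg , f∉ , g∉ with otherEnd itf | otherEnd itg
      ... | x , jf | y , jg = x , y ,
        heads-distinct (toHead f∉ jf) (free itf f∉) (free itg g∉) jf jg f≢g ,
        toHead f∉ jf , toHead g∉ jg

    start≢end : P ∈ ps → 2 ≤ ∣ P ∣ᶜ → start P ≢ end P
    start≢end {comp (stop _)}     _  (s≤s ()) _
    start≢end {comp (step _ _ p)} P∈ _        refl with unique P∈
    ... | n ∷ _ = All.lookup n (end∈ p) refl

    escape-head : P ∈ ps → kind P ≢ even → Closing P → ∣ P ∣ᶜ ≡ 3 → ∃[ t ] ∃[ x ] t ∈ verts P × Head t x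
    escape-head {P} P∈ k≢ c@(_ , j , g∉) l with escape (path P) l (unique P∈) j g∉
    ... | t , x , h , t∈ , x∉ , jt with neighbour P∈ k≢ t∈ (inj₂ (inj₂ c))
        (off-path⇒free P∈ t∈ (proj₁ jt) (λ h∈ → x∉ (edges⊆ (path P) h∈ (proj₁ (proj₂ jt))))) jt
    ... | inj₁ x∈ = ⊥-elim (x∉ x∈)
    ... | inj₂ hd = t , x , t∈ , hd

    isolated-free : comp (stop v) ∈ ps → Incident G v g → Free g
    isolated-free P∈ i = off-path⇒free P∈ (here refl) i λ ()

    isolated-head : comp (stop v) ∈ ps → Joins g v x → Head v x
    isolated-head P∈ j with neighbour P∈ (λ ()) (here refl) (inj₁ refl) (isolated-free P∈ (proj₁ j)) j
    ... | inj₁ (here refl) = ⊥-elim (proj₂ (proj₂ j) refl)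
    ... | inj₂ h           = h

    -- All three edges at `v` are free, and a hidden vertex receives only one free edge, so their
    -- other ends are distinct; with `v` this makes four.
    holding-isolated : comp (stop v) ∈ ps → Holding (comp (stop v)) 4
    holding-isolated {v} P∈ with threeEdges v
    ... | e , f , g , (e≢f , e≢g , f≢g) , ie , if , ig with otherEnd ie | otherEnd if | otherEnd ig
    ... | x , je | y , jf | z , jg = v ∷ x ∷ y ∷ z ∷ [] ,
      (v≢ je ∷ v≢ jf ∷ v≢ jg ∷ []) ∷ (distinct je jf e≢f ∷ distinct je jg e≢g ∷ []) ∷
      (distinct jf jg f≢g ∷ []) ∷ [] ∷ [] ,
      inj₁ (here refl , inj₁ refl) ∷ own je ∷ own jf ∷ own jg ∷ [] ,
      ℕ.≤-refl
      where
      v≢ : ∀ {g x} → Joins g v x → v ≢ x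
      v≢ j = exposed≢head P∈ (here refl) (inj₁ refl) (isolated-head P∈ j)
      distinct : ∀ {f g x y} → Joins f v x → Joins g v y → f ≢ g → x ≢ y
      distinct j k = heads-distinct (isolated-head P∈ j) (isolated-free P∈ (proj₁ j))
        (isolated-free P∈ (proj₁ k)) j k
      own : ∀ {g x} → Joins g v x → Owns (comp (stop v)) x
      own j = inj₂ (v , here refl , isolated-head P∈ j)

    exit : P ∈ ps → Class P short → kind P ≢ even → ∃[ t ] ∃[ x ] t ∈ verts P × Head t x
    exit P∈ (triangle c l) k≢ = escape-head P∈ k≢ c l
    exit {comp (stop v)} P∈ (single _) _ with threeEdges v
    ... | _ , _ , _ , _ , i , _ = _ , _ , here refl , isolated-head P∈ (proj₂ (otherEnd i))
    exit {comp (step _ _ (stop _))}     P∈ (single ()) _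
    exit {comp (step _ _ (step _ _ _))} P∈ (single ()) _

    holding-short : P ∈ ps → Class P short → kind P ≢ even → Holding P 4
    holding-short {P} P∈ (triangle c l) k≢ with escape-head P∈ k≢ c l
    ... | t , x , t∈ , h = x ∷ verts P ,
      All.tabulate (λ v∈ → exposed≢head P∈ v∈ (inj₂ (inj₂ c)) h ∘ sym) ∷ unique P∈ ,
      inj₂ (t , t∈ , h) ∷ All.tabulate (λ v∈ → inj₁ (v∈ , inj₂ (inj₂ c))) ,
      ℕ.≤-reflexive (cong suc (sym l))
    holding-short {comp (stop v)} P∈ (single _) _ = holding-isolated P∈
    holding-short {comp (step _ _ (stop _))}     P∈ (single ()) _
    holding-short {comp (step _ _ (step _ _ _))} P∈ (single ()) _

    -- The six are the two ends and two heads for each. A head determines its claimant, so the heads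
    -- of different ends differ.
    holding-long : P ∈ ps → ¬ Closing P → 2 ≤ ∣ P ∣ᶜ → kind P ≢ even → Holding P 6
    holding-long {P} P∈ ¬c 2≤ k≢
      with end-heads P∈ k≢ ¬c (inj₁ refl) | end-heads P∈ k≢ ¬c (inj₂ refl)
    ... | x , y , x≢y , hx , hy | z , w , z≢w , hz , hw =
      start P ∷ end P ∷ x ∷ y ∷ z ∷ w ∷ [] ,
      (s≢e ∷ s≢ hx ∷ s≢ hy ∷ s≢ hz ∷ s≢ hw ∷ []) ∷
      (e≢ hx ∷ e≢ hy ∷ e≢ hz ∷ e≢ hw ∷ []) ∷
      (x≢y ∷ apart hx hz ∷ apart hx hw ∷ []) ∷ (apart hy hz ∷ apart hy hw ∷ []) ∷
      (z≢w ∷ []) ∷ [] ∷ [] ,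
      inj₁ (start∈ (path P) , inj₁ refl) ∷ inj₁ (end∈ (path P) , inj₂ (inj₁ refl)) ∷
      inj₂ (_ , start∈ (path P) , hx) ∷ inj₂ (_ , start∈ (path P) , hy) ∷
      inj₂ (_ , end∈ (path P) , hz) ∷ inj₂ (_ , end∈ (path P) , hw) ∷ [] ,
      ℕ.≤-refl
      where
      s≢e : start P ≢ end P
      s≢e = start≢end P∈ 2≤
      s≢ : ∀ {t x} → Head t x → start P ≢ x
      s≢ = exposed≢head P∈ (start∈ (path P)) (inj₁ refl)
      e≢ : ∀ {t x} → Head t x → end P ≢ x
      e≢ = exposed≢head P∈ (end∈ (path P)) (inj₂ (inj₁ refl))
      apart : ∀ {x y} → Head (start P) x → Head (end P) y → x ≢ y
      apart h k refl = s≢e (head-unique h k)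

    holding : P ∈ ps → Holding P (capacity (kind P))
    holding {P} P∈ = go (class P) refl
      where
      go : ∀ {k} → Class P k → kind P ≡ k → Holding P (capacity k)
      go (evenCycle _ _ _) _ = [] , [] , [] , z≤n
      go c@(triangle _ _)  q = holding-short P∈ c λ r → contradiction (trans (sym q) r) λ ()
      go c@(single _)      q = holding-short P∈ c λ r → contradiction (trans (sym q) r) λ ()
      go (openPath ¬c l)   q = holding-long P∈ ¬c l λ r → contradiction (trans (sym q) r) λ ()
      go (oddCycle c l)    _ = verts P , unique P∈ , All.tabulate (λ v∈ → inj₁ (v∈ , inj₂ (inj₂ c))) , l

    Disjoint : Comp → Comp → Set
    Disjoint P Q = ∀ {v} → v ∈ verts P → v ∉ verts Q

    disjoint : ∀ qs → Unique (allVerts qs) → AllPairs Disjoint qs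
    disjoint []       _  = []
    disjoint (Q ∷ qs) un with Unique-++⁻ (verts Q) un
    ... | _ , u , d = All.tabulate (λ R∈ v∈Q v∈R → d v∈Q (allVerts⁺ R∈ v∈R)) ∷ disjoint qs u

    collect : ∀ {qs} → (∀ {P} → P ∈ qs → P ∈ ps) → AllPairs Disjoint qs →
              ∃[ xs ] Unique xs × All (λ x → ∃[ P ] P ∈ qs × Owns P x) xs ×
                      total capacity qs ≤ length xs
    collect {[]}     _   _        = [] , [] , [] , z≤n
    collect {Q ∷ qs} sub (d ∷ ds) with holding (sub (here refl)) | collect (sub ∘ there) ds
    ... | xs , ux , ox , lx | ys , uy , oy , ly = xs ++ ys ,
      Unique.++⁺ ux uy (λ (v∈x , v∈y) → meet (All.lookup ox v∈x) (All.lookup oy v∈y)) ,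
      All.++⁺ (All.map (λ o → Q , here refl , o) ox)
              (All.map (λ (P , P∈ , o) → P , there P∈ , o) oy) ,
      subst (_ ≤_) (sym (length-++ xs)) (ℕ.+-mono-≤ lx ly)
      where
      meet : ∀ {v} → Owns Q v → ∃[ P ] P ∈ qs × Owns P v → ⊥
      meet o (P , P∈ , o′) with owner-unique (sub (here refl)) (sub (there P∈)) o o′
      ... | _ , v∈Q , v∈P = All.lookup d P∈ v∈Q v∈P

    capacity≤order : total capacity ps ≤ order G
    capacity≤order with collect (λ P∈ → P∈) (disjoint ps allVerts-unique)
    ... | xs , un , _ , l = ℕ.≤-trans l (subst (length xs ≤_) (length-tabulate (λ v → v))
      (Unique-length-≤ un λ {x} _ → ∈-tabulate⁺ x))

    -- Short components that claim a vertex of an open path.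

    -- Cut `Q` into `K` and `T`, and attach `S` to `T`. If `K` were not short, minimality would
    -- force the merged path `R` to be short; having at least three vertices it would be a triangle,
    -- whose closing edge joins tips of `S` and `Q`.
    attach : ∀ {rest a b x t ks ts e} → ps ↭ S ∷ Q ∷ rest → kind S ≡ short → kind Q ≡ long → Tip S u →
             Joins e u x → (K : Path a b ks) → Path x t ts → ts ++ ks ↭ verts Q → Tip Q t →
             2 ≤ length ts → kind (comp K) ≡ short
    attach {S} {Q} {u} {t = t} {ks} {ts} p kS kQ tS@(_ , xs , pS , rS) j K T r tQ 2≤
      with kind (comp K) ≟ᵏ short
    ... | yes k≡ = k≡
    ... | no k≢  = ⊥-elim (noShort (class R) kR)
      where
      R = comp (append pS j T)
      -- Here 5 = 3 + 2 is the weight of a short and a long component.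
      weights : 5 ≤ weight (kind R) + (weight (kind (comp K)) + 0)
      weights = subst₂ (λ k l → weight k + weight l ≤ _) kS kQ (replace (R ∷ comp K ∷ []) p
        (subst (_↭ _) (sym (trans (cong ((xs ++ ts) ++_) (++-identityʳ ks)) (++-assoc xs ts ks)))
          (++⁺ rS r)))
      kR : kind R ≡ short
      kR with kind R ≟ᵏ short
      ... | yes q = q
      ... | no q  = ⊥-elim (ℕ.<⇒≱ (ℕ.n<1+n 4) (ℕ.≤-trans weights (ℕ.+-mono-≤ (weight-light q)
        (subst (_≤ 2) (sym (ℕ.+-identityʳ _)) (weight-light k≢)))))
      noShort : ∀ {k} → Class R k → k ≢ short
      noShort (single l) refl = ℕ.<⇒≱ (s≤s (s≤s z≤n)) (subst (3 ≤_) (trans (sym (length-++ xs)) l)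
        (ℕ.+-mono-≤ (nonempty pS) 2≤))
      -- As `T` takes at least two of the three vertices, `S` consists of `u` alone, and the closing
      -- edge joins `u` to `t`.
      noShort (triangle (_ , jh , _) l) refl with one pS (ℕ.≤-antisym (ℕ.+-cancelʳ-≤ 2 _ _
        (ℕ.≤-trans (ℕ.+-monoʳ-≤ (length xs) 2≤) (ℕ.≤-reflexive (trans (sym (length-++ xs)) l)))) (nonempty pS))
        where
        one : ∀ {a b xs} → Path a b xs → length xs ≡ 1 → a ≡ b
        one (stop _)                _ = refl
        one (step _ _ (stop _))     ()
        one (step _ _ (step _ _ _)) ()
      ... | refl = tips-apart p (λ q → contradiction (trans (sym kS) q) λ ()) tS tQ jh

    -- Apply `attach` twice: `x` goes once with the part after it and once, reversed, with the part
    -- before it, and the opposite part is left over.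
    pieces-short : S ∈ ps → kind S ≡ short → t ∈ verts S → Q ∈ ps → (h : Hidden Q x) → Joins g t x →
                   kind (comp (left (proj₂ h))) ≡ short × kind (comp (right (proj₂ h))) ≡ short
    pieces-short {S} {t} {Q} {x} S∈ kS t∈ Q∈ h@(_ , i) j with selectTwo S∈ Q∈
    ... | inj₁ refl = contradiction (trans (sym kS) (hidden⇒long S (class S) h)) λ ()
    ... | inj₂ (_ , p) = leftShort , rightShort
      where
      kQ : kind Q ≡ long
      kQ = hidden⇒long Q (class Q) h
      tS : Tip S t
      tS = tip S t∈ (short⇒exposed S (subst (Class S) kS (class S)) t∈)
      leftShort : kind (comp (left i)) ≡ short
      leftShort = attach p kS kQ tS j (left i) (step _ (outof i) (right i))
        (subst (_ ↭_) (sym (splits i)) (++-comm (x ∷ after i) (before i)))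
        (tip Q (end∈ (path Q)) (inj₂ (inj₁ refl))) (s≤s (nonempty (right i)))
      rightShort : kind (comp (right i)) ≡ short
      rightShort with reversePath (left i)
      ... | ls , l , r = attach p kS kQ tS j (right i) (step _ (joins-sym (into i)) l)
        (subst (_ ↭_) (sym (splits i)) (↭-trans (prep x (++⁺ʳ (after i) r)) (↭-sym (shift x (before i) (after i)))))
        (tip Q (start∈ (path Q)) (inj₁ refl)) (s≤s (nonempty l))

    Blocks : Comp → Comp → Set
    Blocks S Q = ∃[ t ] ∃[ x ] t ∈ verts S × (Σ[ h ∈ Hidden Q x ]
      (∃[ g ] Free g × Joins g t x) ×
      Class (comp (left (proj₂ h))) short × Class (comp (right (proj₂ h))) short)

    -- A short left piece has one or three vertices. Equal lengths put `x` and `y` at the same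
    -- position, where `head-unique` identifies the claimants; different lengths are excluded by
    -- `no-crossing`.
    blocks-unique : Q ∈ ps → Blocks S Q → Blocks T Q → ∃[ v ] v ∈ verts S × v ∈ verts T
    blocks-unique {Q} {S} {T} Q∈ (t , x , t∈ , h@(_ , i) , free , li , ri) (u , y , u∈ , k@(_ , j) , free′ , lj , rj) =
      compare li lj
      where
      coincide : before i ++ x ∷ after i ≡ before j ++ y ∷ after j
      coincide = trans (sym (splits i)) (splits j)
      same : length (before i) ≡ length (before j) → ∃[ v ] v ∈ verts S × v ∈ verts T
      same l with ++-injective (before i) (before j) l coincide
      ... | _ , q with ∷-injective q
      ... | refl , _ with head-unique (Q , Q∈ , h , free) (Q , Q∈ , k , free′)
      ... | refl = t , t∈ , u∈
      compare : Class (comp (left i)) short → Class (comp (left j)) short → _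
      compare (single l)           (single m)           = same (trans l (sym m))
      compare (triangle _ l)       (triangle _ m)       = same (trans l (sym m))
      compare (single l)           (triangle (_ , c , _) m) = ⊥-elim (no-crossing l
        (left j) m (nonempty (right j)) coincide (right i) ri (subst Unique (splits i) (unique Q∈))
        c (into j) (outof i))
      compare (triangle (_ , c , _) l) (single m)           = ⊥-elim (no-crossing m
        (left i) l (nonempty (right i)) (sym coincide) (right j) rj (subst Unique (splits j) (unique Q∈))
        c (into i) (outof j))

    -- Every short component has an exit into an open path, which it then blocks; by `blocks-unique`
    -- no path is blocked by two disjoint components.
    shorts≤longs : length (ofKind short ps) ≤ length (ofKind long ps)
    shorts≤longs = pigeonhole (λ S Q → S ∈ ps × Q ∈ ps × Blocks S Q)
      (λ {S} {T} {Q} d (_ , _ , b) (_ , Q∈ , b′) →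
        let _ , v∈S , v∈T = blocks-unique {Q} {S} {T} Q∈ b b′ in d v∈S v∈T)
      (ofKind long ps) (AllPairs.filter⁺ (λ P → kind P ≟ᵏ short) (disjoint ps allVerts-unique)) blocked
      where
      shortly : ∀ {P} → kind P ≡ short → Class P short
      shortly {P} q = subst (Class P) q (class P)
      blocked : ∀ {S} → S ∈ ofKind short ps → ∃[ Q ] Q ∈ ofKind long ps × (S ∈ ps × Q ∈ ps × Blocks S Q)
      blocked S∈′ with ∈-filter⁻ (λ P → kind P ≟ᵏ short) {xs = ps} S∈′
      ... | S∈ , q with exit S∈ (shortly q) (λ r → contradiction (trans (sym q) r) λ ())
      ... | t , x , t∈ , Q , Q∈ , h , free@(_ , _ , j) with pieces-short S∈ q t∈ Q∈ h j
      ... | l , r = Q , ∈-filter⁺ (λ P → kind P ≟ᵏ long) Q∈ (hidden⇒long Q (class Q) h) ,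
        S∈ , Q∈ , t , x , t∈ , h , free , shortly l , shortly r

    cost*5≤order : total cost ps ℕ.* 5 ≤ order G
    cost*5≤order = ℕ.≤-trans (ℕ.+-cancelʳ-≤ (length (ofKind long ps)) _ _
      (ℕ.≤-trans (tally ps) (ℕ.+-monoʳ-≤ (total capacity ps) shorts≤longs))) capacity≤order

  -- From covers to the bound for `ν 2 G`.

  -- With m colored edges and p costly components, the order is n = m + p, so 5n = 5m + 5p is at
  -- most 5m + n.
  fewPaths⇒ν₂ : ∀ ps → allVerts ps ↭ allV → total cost ps ℕ.* 5 ≤ order G → order G ℕ.* 4 ≤ ν 2 G ℕ.* 5
  fewPaths⇒ν₂ ps cover few = ℕ.+-cancelʳ-≤ (order G) _ _ (begin
    order G ℕ.* 4 + order G                   ≡⟨ ℕ.+-comm (order G ℕ.* 4) (order G) ⟩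
    order G + order G ℕ.* 4                   ≡⟨ ℕ.*-suc (order G) 4 ⟨
    order G ℕ.* 5                             ≡⟨ cong (ℕ._* 5) vertices≡ ⟨
    (length m + total cost ps) ℕ.* 5          ≡⟨ ℕ.*-distribʳ-+ 5 (length m) (total cost ps) ⟩
    length m ℕ.* 5 + total cost ps ℕ.* 5      ≤⟨ ℕ.+-mono-≤ (ℕ.*-monoˡ-≤ 5 m≤ν) few ⟩
    ν 2 G ℕ.* 5 + order G                     ∎)
    where
    open ℕ.≤-Reasoning
    m = colourAll ps
    vertices≡ : length m + total cost ps ≡ order G
    vertices≡ = trans (colourAll-length ps) (trans (↭-length cover) (length-tabulate (λ v → v)))
    m≤ν : length m ≤ ν 2 G
    m≤ν = length≤ν₂ (colourAll-compatible ps
      (Unique-resp-↭ (↭-sym cover) (Unique.allFin⁺ (order G))))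

  -- The claim is decidable, so a minimal cover need not be computed: if the
  -- claim failed, no cover with smaller weight could exist.
  covered⇒ν₂ : ∀ ps → allVerts ps ↭ allV → Acc _<_ (total weight ps) → order G ℕ.* 4 ≤ ν 2 G ℕ.* 5
  covered⇒ν₂ ps cover (acc rec) = decidable-stable (_ ℕ.≤? _) λ ¬claim →
    ¬claim (fewPaths⇒ν₂ ps cover (Minimal.cost*5≤order ps cover λ qs cover′ →
      ℕ.≮⇒≥ λ lighter → ¬claim (covered⇒ν₂ qs cover′ (rec lighter))))

  order*4≤ν₂*5 : order G ℕ.* 4 ≤ ν 2 G ℕ.* 5
  -- Any cover can start the descent; here every vertex is a component of its own.
  order*4≤ν₂*5 = covered⇒ν₂ (map (λ v → comp (stop v)) allV)
    (↭-reflexive (trans (concatMap-map verts (λ v → comp (stop v)) allV) (concatMap-pure allV)))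
    (<-wellFounded _)

-- The bound as an inequality of rationals.

theorem2 : (G : Graph) → Cubic G → + ν 2 G / 1 ≥ (+ 4 / 5) * (+ order G / 1)
theorem2 G cubic = ℚ.toℚᵘ-cancel-≤ (begin
  toℚᵘ ((+ 4 / 5) * (+ order G / 1))           ≃⟨ ℚ.toℚᵘ-homo-* (+ 4 / 5) (+ order G / 1) ⟩
  toℚᵘ (+ 4 / 5) ℚᵘ.* toℚᵘ (+ order G / 1)
    ≃⟨ ℚᵘ.*-congˡ {ℚᵘ.mkℚᵘ (+ 4) 4} (ℚ.toℚᵘ-fromℚᵘ (ℚᵘ.mkℚᵘ (+ order G) 0)) ⟩
  ℚᵘ.mkℚᵘ (+ 4) 4 ℚᵘ.* ℚᵘ.mkℚᵘ (+ order G) 0     ≤⟨ ℚᵘ.*≤* bound ⟩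
  ℚᵘ.mkℚᵘ (+ ν 2 G) 0                           ≃⟨ ℚ.toℚᵘ-fromℚᵘ (ℚᵘ.mkℚᵘ (+ ν 2 G) 0) ⟨
  toℚᵘ (+ ν 2 G / 1)                          ∎)
  where
  open ℚᵘ.≤-Reasoning
  bound : (+ 4 ℤ.* + order G) ℤ.* + 1 ℤ.≤ + ν 2 G ℤ.* + 5
  bound = subst₂ ℤ._≤_
    (trans (cong +_ (ℕ.*-comm (order G) 4))
      (trans (ℤ.pos-* 4 (order G)) (sym (ℤ.*-identityʳ (+ 4 ℤ.* + order G)))))
    (ℤ.pos-* (ν 2 G) 5)
    (ℤ.+≤+ (CubicWalks.order*4≤ν₂*5 G cubic))
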